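{- For every integer $v\ge 2$, the $(v,2,1)$-BIBD on a $v$-set $X$ (whose blocks are all $2$-subsets of $X$) has a weak nesting $\phi:\mathcal{A}\to Y$ with $X\subseteq Y$ and $|Y|=w=\left\lceil \frac{5v-1}{4}\right\rceil$, and this is optimal, i.e. no weak nesting of this BIBD has $|Y|<\left\lceil \frac{5v-1}{4}\right\rceil$.
   Context: A $(v,k,\lambda)$-BIBD is a pair $(X,\mathcal{A})$ where $X$ is a set of $v$ points and $\mathcal{A}$ is a multiset of $k$-subsets of $X$ (blocks) such that every pair of distinct points lies in exactly $\lambda$ blocks. A partial $(w,k,\lambda)$-BIBD is defined in the same way on $w$ points, except that every pair lies in at most $\lambda$ blocks. Given a $(v,k,\lambda)$-BIBD $(X,\mathcal{A})$ and a set $Y\supseteq X$ with $|Y|=w$, a map $\phi:\mathcal{A}\to Y$ is a weak nesting if $\phi(A)\notin A$ for every block $A$ and the multiset $\{A\cup\{\phi(A)\}:A\in\mathcal{A}\}$ is a partial $(w,k+1,\lambda+1)$-BIBD on $Y$. A weak nesting is optimal if $w=|Y|$ is as small as possible. -}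

module Defs where

open import Data.Bool.Base using (true; false)
open import Data.Fin.Base using (Fin; zero; suc)
open import Data.Fin.Properties using (any?; _≟_; suc-injective)
open import Data.Fin.Subset using (Subset; inside; outside; _∉_; _∪_; ⁅_⁆; ∣_∣)
open import Data.Fin.Subset.Properties using (_∈?_; ∣⁅x⁆∣≡1; x∈⁅y⁆⇒x≡y; x∈⁅x⁆)
open import Data.Nat.Base using (ℕ; zero; suc; _+_; _≤_; pred; NonZero; _/_)
open import Data.Vec.Base using (Vec; []; _∷_; _++_; count; lookup; map; tabulate; allFin)
open import Data.Vec.Relation.Unary.All as All using (All; []; _∷_)
import Data.Vec.Relation.Unary.All.Properties as All
open import Function.Base using (_∘_)
open import Function.Bundles using (_↣_; module Injection)
open import Relation.Binary.PropositionalEquality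
open import Relation.Nullary using (does; yes; no; contradiction)
open import Relation.Nullary.Decidable using (_×-dec_)
open import Relation.Unary using (Decidable)

private
  variable
    v w k ƛ b m n : ℕ

-- A multiset of blocks is a vector, its elements counted with repetition.
-- Only properties invariant under reordering are imposed on it.

pairCount : Vec (Subset v) b → Fin v → Fin v → ℕ
pairCount 𝒜 x y = count (λ A → (x ∈? A) ×-dec (y ∈? A)) 𝒜

record BIBD (v k ƛ : ℕ) : Set where
  field
    {blockCount} : ℕ
    blocks       : Vec (Subset v) blockCount
    block-size   : All (λ A → ∣ A ∣ ≡ k) blocks
    balanced     : ∀ {x y} → x ≢ y → pairCount blocks x y ≡ ƛ

record IsPartialBIBD (w k ƛ : ℕ) (𝒜 : Vec (Subset w) b) : Set where
  field
    block-size : All (λ A → ∣ A ∣ ≡ k) 𝒜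
    packed     : ∀ {x y} → x ≢ y → pairCount 𝒜 x y ≤ ƛ

image : (Fin v → Fin w) → Subset v → Subset w
image f A = tabulate λ y → does (any? λ x → (x ∈? A) ×-dec (f x ≟ y))

-- The inclusion X ⊆ Y of a v-set in a w-set is an arbitrary injection ι.
-- The map φ is defined on block occurrences, i.e. on indices of blocks, so
-- equal blocks may be sent to different points.

record WeakNesting (𝒟 : BIBD v k ƛ) (w : ℕ) : Set where
  open BIBD 𝒟 using (blockCount; blocks)
  field
    ι : Fin v ↣ Fin w
    φ : Fin blockCount → Fin w

  blockInY : Fin blockCount → Subset w
  blockInY i = image (Injection.to ι) (lookup blocks i)

  field
    φ∉block : ∀ i → φ i ∉ blockInY i
    partial : IsPartialBIBD w (suc k) (suc ƛ) (tabulate λ i → blockInY i ∪ ⁅ φ i ⁆)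

IsOptimal : {𝒟 : BIBD v k ƛ} → WeakNesting 𝒟 w → Set
IsOptimal {w = w} {𝒟 = 𝒟} _ = ∀ {w′} → WeakNesting 𝒟 w′ → w ≤ w′

⌈_/_⌉ : (m n : ℕ) .{{_ : NonZero n}} → ℕ
⌈ m / n ⌉ = (m + pred n) / n

-- All 2-subsets of a v-set form a (v,2,1)-BIBD, so BIBD v 2 1 is inhabited.
-- Conversely, the blocks of any (v,2,1)-BIBD are the 2-subsets, once each.

pairNumber : ℕ → ℕ
pairNumber zero    = 0
pairNumber (suc n) = n + pairNumber n

allPairs : ∀ n → Vec (Subset n) (pairNumber n)
allPairs zero    = []
allPairs (suc n) = map ((inside ∷_) ∘ ⁅_⁆) (allFin n) ++ map (outside ∷_) (allPairs n)

private
  module _ {A : Set} {P : A → Set} (P? : Decidable P) where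

    count-++ : (xs : Vec A m) (ys : Vec A n) →
               count P? (xs ++ ys) ≡ count P? xs + count P? ys
    count-++ []       ys = refl
    count-++ (x ∷ xs) ys with does (P? x)
    ... | true  = cong suc (count-++ xs ys)
    ... | false = count-++ xs ys

  pairCount-++ : (𝒜 : Vec (Subset v) m) (ℬ : Vec (Subset v) n) → ∀ x y →
                 pairCount (𝒜 ++ ℬ) x y ≡ pairCount 𝒜 x y + pairCount ℬ x y
  pairCount-++ 𝒜 ℬ x y = count-++ _ 𝒜 ℬ

  pairCount-comm : (𝒜 : Vec (Subset v) n) → ∀ x y → pairCount 𝒜 x y ≡ pairCount 𝒜 y x
  pairCount-comm []      x y = refl
  pairCount-comm (A ∷ 𝒜) x y with does (x ∈? A) | does (y ∈? A)
  ... | true  | true  = cong suc (pairCount-comm 𝒜 x y)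
  ... | true  | false = pairCount-comm 𝒜 x y
  ... | false | true  = pairCount-comm 𝒜 x y
  ... | false | false = pairCount-comm 𝒜 x y

  zero∉ : (𝒜 : Vec (Subset v) n) → ∀ y → pairCount (map (outside ∷_) 𝒜) zero y ≡ 0
  zero∉ []      y = refl
  zero∉ (A ∷ 𝒜) y = zero∉ 𝒜 y

  pairCount-outside : (𝒜 : Vec (Subset v) n) → ∀ x y →
    pairCount (map (outside ∷_) 𝒜) (suc x) (suc y) ≡ pairCount 𝒜 x y
  pairCount-outside []      x y = refl
  pairCount-outside (A ∷ 𝒜) x y with x ∈? A | y ∈? A
  ... | yes _ | yes _ = cong suc (pairCount-outside 𝒜 x y)
  ... | yes _ | no  _ = pairCount-outside 𝒜 x y
  ... | no  _ | yes _ = pairCount-outside 𝒜 x y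
  ... | no  _ | no  _ = pairCount-outside 𝒜 x y

  star : Vec (Fin n) m → Vec (Subset (suc n)) m
  star = map ((inside ∷_) ∘ ⁅_⁆)

  star-rim : (zs : Vec (Fin n) m) → ∀ {x y} → x ≢ y → pairCount (star zs) (suc x) (suc y) ≡ 0
  star-rim []       x≢y = refl
  star-rim (z ∷ zs) {x} {y} x≢y with x ∈? ⁅ z ⁆ | y ∈? ⁅ z ⁆
  ... | yes p | yes q = contradiction (trans (x∈⁅y⁆⇒x≡y z p) (sym (x∈⁅y⁆⇒x≡y z q))) x≢y
  ... | yes _ | no  _ = star-rim zs x≢y
  ... | no  _ | yes _ = star-rim zs x≢y
  ... | no  _ | no  _ = star-rim zs x≢y

  star-none : (f : Fin m → Fin n) → ∀ y → (∀ i → f i ≢ y) →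
              pairCount (star (tabulate f)) zero (suc y) ≡ 0
  star-none {zero}  f y f≢y = refl
  star-none {suc m} f y f≢y with y ∈? ⁅ f zero ⁆
  ... | yes p = contradiction (sym (x∈⁅y⁆⇒x≡y (f zero) p)) (f≢y zero)
  ... | no  _ = star-none (f ∘ suc) y (f≢y ∘ suc)

  star-one : (f : Fin m → Fin n) → (∀ {i j} → f i ≡ f j → i ≡ j) → ∀ i →
             pairCount (star (tabulate f)) zero (suc (f i)) ≡ 1
  star-one f inj zero with f zero ∈? ⁅ f zero ⁆
  ... | yes _ = cong suc (star-none (f ∘ suc) (f zero) λ j e → contradiction (inj e) λ ())
  ... | no  p = contradiction (x∈⁅x⁆ (f zero)) p
  star-one f inj (suc i) with f (suc i) ∈? ⁅ f zero ⁆
  ... | yes p = contradiction (inj (x∈⁅y⁆⇒x≡y (f zero) p)) λ ()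
  ... | no  _ = star-one (f ∘ suc) (suc-injective ∘ inj) i

  allPairs-size : ∀ n → All (λ A → ∣ A ∣ ≡ 2) (allPairs n)
  allPairs-size zero    = []
  allPairs-size (suc n) = All.++⁺
    (All.map⁺ (All.universal (cong suc ∘ ∣⁅x⁆∣≡1) (allFin n)))
    (All.map⁺ (allPairs-size n))

  allPairs-zero : ∀ n (y : Fin n) → pairCount (allPairs (suc n)) zero (suc y) ≡ 1
  allPairs-zero n y = trans
    (pairCount-++ (star (allFin n)) (map (outside ∷_) (allPairs n)) zero (suc y))
    (cong₂ _+_ (star-one (λ i → i) (λ e → e) y) (zero∉ (allPairs n) (suc y)))

  allPairs-balanced : ∀ n {x y : Fin n} → x ≢ y → pairCount (allPairs n) x y ≡ 1
  allPairs-balanced (suc n) {zero}  {zero}  x≢y = contradiction refl x≢y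
  allPairs-balanced (suc n) {zero}  {suc y} x≢y = allPairs-zero n y
  allPairs-balanced (suc n) {suc x} {zero}  x≢y =
    trans (pairCount-comm (allPairs (suc n)) (suc x) zero) (allPairs-zero n x)
  allPairs-balanced (suc n) {suc x} {suc y} x≢y = trans
    (pairCount-++ (star (allFin n)) (map (outside ∷_) (allPairs n)) (suc x) (suc y))
    (cong₂ _+_ (star-rim (allFin n) (x≢y ∘ cong suc))
               (trans (pairCount-outside (allPairs n) x y)
                      (allPairs-balanced n (x≢y ∘ cong suc))))

allPairsBIBD : ∀ v → BIBD v 2 1
allPairsBIBD v = record
  { blocks     = allPairs v
  ; block-size = allPairs-size v
  ; balanced   = allPairs-balanced v
  }

{-# OPTIONS --safe #-}

-- Lower bound: call {x , y} ⊆ X used when some 2-subset {x , z} is nested on y or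
-- {y , z} on x. As {x , y} is itself a block, it is used at most once, and a nesting
-- into X uses two pairs, so at most half of the 2-subsets are nested inside X. A new
-- point meets every x at most twice, so it receives at most v of them. Hence
-- v(v−1)/2 ≤ v(v−1)/4 + v(w−v), i.e. 5v − 1 ≤ 4w.
-- Upper bound: develop a starter cyclically, nesting half of the differences inside X
-- and sending each remaining difference class to a new point of its own (for 4 ∣ v the
-- cyclic group acts on all points but one).

module Submission where

open import Defs
import Data.Bool.Properties as Bool
open import Data.Bool.Base using (Bool; true; false)
open import Data.Empty using (⊥)
open import Data.Fin.Base as Fin using (Fin; zero; suc; toℕ; fromℕ<; _↑ˡ_; _↑ʳ_; splitAt; join)
open import Data.Fin.Properties as Fin
  using (any?; injective⇒≤; _≟_; suc-injective; toℕ<n; toℕ-fromℕ<; toℕ-injective; *↔×; +↔⊎; 2↔Bool)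
open import Data.Fin.Subset using (Subset; inside; outside; _∈_; _∉_; _⊆_; _∪_; ⁅_⁆; ∣_∣)
open import Data.Fin.Subset.Properties
  using (_∈?_; x∈⁅x⁆; x∈⁅y⁆⇒x≡y; x∈p∪q⁺; x∈p∪q⁻; ∪-identityʳ; ∣⁅x⁆∣≡1; ⊆-antisym)
open import Data.Nat.Base
  using (ℕ; zero; suc; _+_; _*_; _∸_; _/_; _%_; _≤_; _<_; z≤n; s≤s; z<s; s≤s⁻¹; NonZero)
open import Data.Nat.Divisibility using (n∣m*n)
open import Data.Nat.DivMod
  using (_mod_; _divMod_; result; m%n<n; m%n%n≡m%n; %-distribˡ-+; [m+n]%n≡m%n; [m+kn]%n≡m%n;
         m<n⇒m%n≡m; m<n*o⇒m/o<n; m<n⇒m/n≡0; m*n/n≡m; +-distrib-/-∣ʳ)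
import Data.Nat.Properties as ℕ
open import Data.Nat.Tactic.RingSolver using (solve-∀)
open import Data.Product.Base using (Σ-syntax; ∃; ∃-syntax; _×_; _,_; proj₁; proj₂; swap; map₂)
open import Data.Product.Function.NonDependent.Propositional using (_×-↔_)
open import Data.Sum.Base as Sum using (_⊎_; inj₁; inj₂)
open import Data.Sum.Function.Propositional using (_⊎-↔_)
open import Data.Sum.Properties using (inj₂-injective)
open import Data.Vec.Base using (Vec; []; _∷_; lookup; tabulate; count; here; there)
open import Data.Vec.Properties using (lookup∘tabulate; []=⇒lookup; lookup⇒[]=)
import Data.Vec.Relation.Unary.All.Properties as All
open import Function.Base using (_∘_)
open import Function.Bundles using (_↔_; mk↣; module Injection; module Inverse)
open import Function.Construct.Composition using (_↔-∘_)
open import Function.Construct.Identity using (↔-id)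
open import Function.Definitions using (Injective)
open import Function.Properties.Inverse using (↔-sym; ↔⇒↣)
open import Level using (0ℓ)
open import Relation.Binary.Definitions using (tri<; tri≈; tri>)
open import Relation.Binary.PropositionalEquality
open import Relation.Nullary using (¬_; Dec; does; yes; no; contradiction)
open import Relation.Nullary.Decidable using (_×-dec_; ¬?; dec-true)
open import Relation.Unary using (Pred; Decidable)

-- Counting the entries of a vector that satisfy a predicate.

module _ {A : Set} {P : Pred A 0ℓ} (P? : Decidable P) where

  -- With `hit-sound`, `hit-injective` and `hit-complete` this is a bijection from
  -- `Fin (count P? xs)` to the positions where `P` holds, so that bounds on `count` become
  -- injections between finite sets.
  hit : ∀ {n} (xs : Vec A n) → Fin (count P? xs) → Fin n
  hit (x ∷ xs) j with P? x
  hit (x ∷ xs) zero    | yes _ = zero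
  hit (x ∷ xs) (suc j) | yes _ = suc (hit xs j)
  hit (x ∷ xs) j       | no  _ = suc (hit xs j)

  hit-sound : ∀ {n} (xs : Vec A n) j → P (lookup xs (hit xs j))
  hit-sound (x ∷ xs) j with P? x
  hit-sound (x ∷ xs) zero    | yes p = p
  hit-sound (x ∷ xs) (suc j) | yes _ = hit-sound xs j
  hit-sound (x ∷ xs) j       | no  _ = hit-sound xs j

  hit-injective : ∀ {n} (xs : Vec A n) → Injective _≡_ _≡_ (hit xs)
  hit-injective (x ∷ xs) {i} {j} eq with P? x
  hit-injective (x ∷ xs) {zero}  {zero}  eq | yes _ = refl
  hit-injective (x ∷ xs) {suc i} {suc j} eq | yes _ = cong suc (hit-injective xs (suc-injective eq))
  hit-injective (x ∷ xs) {i}     {j}     eq | no  _ = hit-injective xs (suc-injective eq)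

  hit-complete : ∀ {n} (xs : Vec A n) i → P (lookup xs i) → ∃[ j ] hit xs j ≡ i
  hit-complete (x ∷ xs) i p with P? x
  hit-complete (x ∷ xs) zero    p | yes _ = zero , refl
  hit-complete (x ∷ xs) (suc i) p | yes _ = let j , eq = hit-complete xs i p in suc j , cong suc eq
  hit-complete (x ∷ xs) zero    p | no ¬p = contradiction p ¬p
  hit-complete (x ∷ xs) (suc i) p | no _  = let j , eq = hit-complete xs i p in j , cong suc eq

  count-≤ : ∀ {n k} (xs : Vec A n) (c : Fin n → Fin k) →
            (∀ i j → P (lookup xs i) → P (lookup xs j) → c i ≡ c j → i ≡ j) → count P? xs ≤ k
  count-≤ xs c inj = injective⇒≤ {f = c ∘ hit xs} λ {i} {j} eq →
    hit-injective xs (inj _ _ (hit-sound xs i) (hit-sound xs j) eq)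

  count-≥ : ∀ {n k} (xs : Vec A n) (e : Fin k → Fin n) → Injective _≡_ _≡_ e →
            (∀ j → P (lookup xs (e j))) → k ≤ count P? xs
  count-≥ xs e e-inj p = injective⇒≤ {f = λ j → proj₁ (hit-complete xs (e j) (p j))} λ {i} {j} eq →
    e-inj (trans (sym (proj₂ (hit-complete xs (e i) (p i))))
          (trans (cong (hit xs) eq) (proj₂ (hit-complete xs (e j) (p j)))))

  count≡1⇒unique : ∀ {n} {xs : Vec A n} → count P? xs ≡ 1 →
                   ∀ {i j} → P (lookup xs i) → P (lookup xs j) → i ≡ j
  count≡1⇒unique {xs = xs} eq {i} {j} pi pj
    with hit-complete xs i pi | hit-complete xs j pj
  ... | a , refl | b , refl = cong (hit xs) (all-equal eq a b)
    where
    all-equal : ∀ {n} → n ≡ 1 → (a b : Fin n) → a ≡ b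
    all-equal refl zero zero = refl

  count≤2⇒no-three : ∀ {n} {xs : Vec A n} → count P? xs ≤ 2 → ∀ {i j l} →
                     i ≢ j → i ≢ l → j ≢ l →
                     P (lookup xs i) → P (lookup xs j) → P (lookup xs l) → ⊥
  count≤2⇒no-three {n} {xs} ≤2 {i} {j} {l} i≢j i≢l j≢l pi pj pl =
    ℕ.1+n≰n (ℕ.≤-trans (count-≥ xs e e-inj p) ≤2)
    where
    e : Fin 3 → Fin n
    e = lookup (i ∷ j ∷ l ∷ [])
    p : ∀ m → P (lookup xs (e m))
    p zero = pi
    p (suc zero) = pj
    p (suc (suc zero)) = pl
    e-inj : Injective _≡_ _≡_ e
    e-inj {zero}          {zero}          eq = refl
    e-inj {zero}          {suc zero}      eq = contradiction eq i≢j
    e-inj {zero}          {suc (suc zero)} eq = contradiction eq i≢l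
    e-inj {suc zero}      {zero}          eq = contradiction (sym eq) i≢j
    e-inj {suc zero}      {suc zero}      eq = refl
    e-inj {suc zero}      {suc (suc zero)} eq = contradiction eq j≢l
    e-inj {suc (suc zero)} {zero}          eq = contradiction (sym eq) i≢l
    e-inj {suc (suc zero)} {suc zero}      eq = contradiction (sym eq) j≢l
    e-inj {suc (suc zero)} {suc (suc zero)} eq = refl

-- Images under injections and two-element subsets.

∈-image⁺ : ∀ {v w} (f : Fin v → Fin w) {A x} → x ∈ A → f x ∈ image f A
∈-image⁺ f {A} {x} x∈A = lookup⇒[]= (f x) _ (trans (lookup∘tabulate _ (f x))
  (dec-true (any? λ z → (z ∈? A) ×-dec (f z ≟ f x)) (x , x∈A , refl)))

∈-image⁻ : ∀ {v w} (f : Fin v → Fin w) {A y} → y ∈ image f A → ∃[ x ] x ∈ A × f x ≡ y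
∈-image⁻ f {A} {y} y∈ = witness (any? λ x → (x ∈? A) ×-dec (f x ≟ y))
  (trans (sym (lookup∘tabulate _ y)) ([]=⇒lookup y∈))
  where
  witness : ∀ {a} {X : Set a} (X? : Dec X) → does X? ≡ true → X
  witness (yes x) _ = x

record Doubleton {n} (A : Subset n) : Set where
  field
    fst snd   : Fin n
    fst≢snd   : fst ≢ snd
    fst∈      : fst ∈ A
    snd∈      : snd ∈ A
    exhausted : ∀ {x} → x ∈ A → x ≡ fst ⊎ x ≡ snd

doubleton : ∀ {n} {A : Subset n} → ∣ A ∣ ≡ 2 → Doubleton A
doubleton {n} {A} size = enumerated size
  (hit inside? A) (hit-sound inside? A) (hit-injective inside? A) (hit-complete inside? A)
  where
  -- A subset is a Boolean vector whose size is by definition its count of `inside`, so `hit`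
  -- enumerates the elements. The size is generalised to `m` below so that `m ≡ 2` can be matched
  -- with `refl`.
  inside? = Bool._≟ inside
  enumerated : ∀ {m} → m ≡ 2 → (e : Fin m → Fin n) → (∀ j → lookup A (e j) ≡ inside) →
               Injective _≡_ _≡_ e → (∀ i → lookup A i ≡ inside → ∃[ j ] e j ≡ i) → Doubleton A
  enumerated refl e sound inj complete = record
    { fst = e zero
    ; snd = e (suc zero)
    ; fst≢snd = λ eq → contradiction (inj eq) λ ()
    ; fst∈ = lookup⇒[]= _ A (sound zero)
    ; snd∈ = lookup⇒[]= _ A (sound (suc zero))
    ; exhausted = λ x∈A → cases (complete _ ([]=⇒lookup x∈A))
    }
    where
    cases : ∀ {x} → ∃[ j ] e j ≡ x → x ≡ e zero ⊎ x ≡ e (suc zero)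
    cases (zero     , refl) = inj₁ refl
    cases (suc zero , refl) = inj₂ refl

∣p∪⁅x⁆∣≡1+∣p∣ : ∀ {n} {p : Subset n} {x} → x ∉ p → ∣ p ∪ ⁅ x ⁆ ∣ ≡ suc ∣ p ∣
∣p∪⁅x⁆∣≡1+∣p∣ {p = inside  ∷ p} {zero}  x∉p = contradiction here x∉p
∣p∪⁅x⁆∣≡1+∣p∣ {p = outside ∷ p} {zero}  x∉p = cong (suc ∘ ∣_∣) (∪-identityʳ p)
∣p∪⁅x⁆∣≡1+∣p∣ {p = inside  ∷ p} {suc x} x∉p = cong suc (∣p∪⁅x⁆∣≡1+∣p∣ {p = p} (x∉p ∘ there))
∣p∪⁅x⁆∣≡1+∣p∣ {p = outside ∷ p} {suc x} x∉p = ∣p∪⁅x⁆∣≡1+∣p∣ {p = p} (x∉p ∘ there)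

∣⁅x⁆∪⁅y⁆∣≡2 : ∀ {n} {x y : Fin n} → x ≢ y → ∣ ⁅ x ⁆ ∪ ⁅ y ⁆ ∣ ≡ 2
∣⁅x⁆∪⁅y⁆∣≡2 {x = x} x≢y = trans (∣p∪⁅x⁆∣≡1+∣p∣ {p = ⁅ x ⁆} (x≢y ∘ sym ∘ x∈⁅y⁆⇒x≡y x)) (cong suc (∣⁅x⁆∣≡1 x))

∣image∣≡2 : ∀ {v w} (f : Fin v → Fin w) → Injective _≡_ _≡_ f → ∀ {A} → ∣ A ∣ ≡ 2 → ∣ image f A ∣ ≡ 2
∣image∣≡2 f f-inj {A} size = trans (cong ∣_∣ (⊆-antisym to from)) (∣⁅x⁆∪⁅y⁆∣≡2 (fst≢snd ∘ f-inj))
  where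
  open Doubleton (doubleton {A = A} size)
  to : image f A ⊆ ⁅ f fst ⁆ ∪ ⁅ f snd ⁆
  to y∈ with ∈-image⁻ f y∈
  ... | x , x∈A , refl with exhausted x∈A
  ...   | inj₁ refl = x∈p∪q⁺ (inj₁ (x∈⁅x⁆ _))
  ...   | inj₂ refl = x∈p∪q⁺ (inj₂ (x∈⁅x⁆ _))
  from : ⁅ f fst ⁆ ∪ ⁅ f snd ⁆ ⊆ image f A
  from y∈ with x∈p∪q⁻ ⁅ f fst ⁆ ⁅ f snd ⁆ y∈
  ... | inj₁ p rewrite x∈⁅y⁆⇒x≡y _ p = ∈-image⁺ f fst∈
  ... | inj₂ p rewrite x∈⁅y⁆⇒x≡y _ p = ∈-image⁺ f snd∈

-- The blocks of a (v,2,1)-BIBD.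

module Pairs {v} (𝒟 : BIBD v 2 1) where
  open BIBD 𝒟 public using (blocks; blockCount)

  block : Fin blockCount → Subset v
  block = lookup blocks

  size : ∀ i → ∣ block i ∣ ≡ 2
  size = All.lookup⁺ (BIBD.block-size 𝒟)

  both? : ∀ x y (A : Subset v) → Dec (x ∈ A × y ∈ A)
  both? x y A = (x ∈? A) ×-dec (y ∈? A)

  through : ∀ {x y} → x ≢ y → ∃[ i ] x ∈ block i × y ∈ block i
  through {x} {y} x≢y = hit (both? x y) blocks first , hit-sound (both? x y) blocks first
    where
    first : Fin (pairCount blocks x y)
    first = subst Fin (sym (BIBD.balanced 𝒟 x≢y)) zero

  unique-block : ∀ {x y i j} → x ≢ y → x ∈ block i → y ∈ block i →
                 x ∈ block j → y ∈ block j → i ≡ j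
  unique-block {x} {y} x≢y xi yi xj yj =
    count≡1⇒unique (both? x y) {xs = blocks} (BIBD.balanced 𝒟 x≢y) (xi , yi) (xj , yj)

  no-three-points : ∀ {i x y z} → x ≢ y → x ≢ z → y ≢ z →
                    x ∈ block i → y ∈ block i → z ∈ block i → ⊥
  no-three-points {i} x≢y x≢z y≢z x∈ y∈ z∈ = cases (exhausted x∈) (exhausted y∈) (exhausted z∈)
    where
    open Doubleton (doubleton {A = block i} (size i))
    cases : _ → _ → _ → ⊥
    cases (inj₁ refl) (inj₁ refl) _           = x≢y refl
    cases (inj₁ refl) (inj₂ refl) (inj₁ refl) = x≢z refl
    cases (inj₁ refl) (inj₂ refl) (inj₂ refl) = y≢z refl
    cases (inj₂ refl) (inj₁ refl) (inj₁ refl) = y≢z refl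
    cases (inj₂ refl) (inj₁ refl) (inj₂ refl) = x≢z refl
    cases (inj₂ refl) (inj₂ refl) _           = x≢y refl

-- Lower bound on the size of Y.

module LowerBound {v w} (𝒟 : BIBD v 2 1) (N : WeakNesting 𝒟 w) where
  open Pairs 𝒟
  open WeakNesting N hiding (ι)
  open IsPartialBIBD partial using (packed)

  ι : Fin v → Fin w
  ι = Injection.to (WeakNesting.ι N)

  ι-injective : Injective _≡_ _≡_ ι
  ι-injective = Injection.injective (WeakNesting.ι N)

  triple : Fin blockCount → Subset w
  triple i = blockInY i ∪ ⁅ φ i ⁆

  block⊆triple : ∀ {i x} → x ∈ block i → ι x ∈ triple i
  block⊆triple x∈ = x∈p∪q⁺ (inj₁ (∈-image⁺ ι x∈))

  φ∈triple : ∀ {i p} → φ i ≡ p → p ∈ triple i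
  φ∈triple refl = x∈p∪q⁺ (inj₂ (x∈⁅x⁆ _))

  φ≢ι : ∀ {i x} → x ∈ block i → φ i ≢ ι x
  φ≢ι {i} x∈ eq = φ∉block i (subst (_∈ blockInY i) (sym eq) (∈-image⁺ ι x∈))

  -- `packed` allows λ + 1 = 2 triples through a pair; `nested-inner-unique`, `nested-inner-asym`
  -- and `nested-no-three` each exhibit a forbidden third.
  no-three-triples : ∀ {p q i j l} → p ≢ q → i ≢ j → i ≢ l → j ≢ l →
    p ∈ triple i × q ∈ triple i → p ∈ triple j × q ∈ triple j → p ∈ triple l × q ∈ triple l → ⊥
  no-three-triples {p} {q} p≢q i≢j i≢l j≢l ti tj tl =
    count≤2⇒no-three (λ A → (p ∈? A) ×-dec (q ∈? A)) {xs = tabulate triple} (packed p≢q)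
      i≢j i≢l j≢l (at ti) (at tj) (at tl)
    where
    at : ∀ {i} → p ∈ triple i × q ∈ triple i → p ∈ lookup (tabulate triple) i × q ∈ lookup (tabulate triple) i
    at {i} = subst (λ A → p ∈ A × q ∈ A) (sym (lookup∘tabulate triple i))

  -- Ordered form of nesting: a block {x , z} with image y gives both `Nested x z y` and
  -- `Nested z x y`, so each block is counted as two ordered pairs.
  Nested : Fin v → Fin v → Fin w → Set
  Nested x z y = ∃[ i ] x ≢ z × x ∈ block i × z ∈ block i × φ i ≡ y

  nested? : ∀ x z y → Dec (Nested x z y)
  nested? x z y = any? λ i → ¬? (x ≟ z) ×-dec (x ∈? block i) ×-dec (z ∈? block i) ×-dec (φ i ≟ y)

  nested-exists : ∀ {x z} → x ≢ z → ∃ (Nested x z)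
  nested-exists x≢z = let i , x∈ , z∈ = through x≢z in φ i , i , x≢z , x∈ , z∈ , refl

  nested-≢ : ∀ {x z} → ¬ Nested x z (ι x)
  nested-≢ (i , _ , x∈ , _ , eq) = φ≢ι x∈ eq

  nested-index-≢ : ∀ {x z z′ y y′} → z ≢ z′ → ((i , _) : Nested x z y) ((j , _) : Nested x z′ y′) → i ≢ j
  nested-index-≢ z≢z′ (i , x≢z , x∈ , z∈ , _) (_ , x≢z′ , _ , z′∈ , _) refl =
    no-three-points x≢z x≢z′ z≢z′ x∈ z∈ z′∈

  -- Otherwise the two triples and that of the block {x , y} would be three through `ι x` and `ι y`.
  -- The third block differs from the others because y lies in it but is their image.
  nested-inner-unique : ∀ {x z z′ y} → Nested x z (ι y) → Nested x z′ (ι y) → z ≡ z′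
  nested-inner-unique {x} {z} {z′} {y} n@(i , _ , xi , _ , φi) n′@(j , _ , xj , _ , φj) with z ≟ z′ | x ≟ y
  ... | yes z≡z′ | _        = z≡z′
  ... | no  _    | yes refl = contradiction n nested-≢
  ... | no  z≢z′ | no  x≢y  = let l , xl , yl = through x≢y in contradiction
    (φ∈triple φj) λ yj → no-three-triples (x≢y ∘ ι-injective)
      (nested-index-≢ z≢z′ n n′)
      (λ { refl → φ≢ι yl φi }) (λ { refl → φ≢ι yl φj })
      (block⊆triple xi , φ∈triple φi) (block⊆triple xj , yj) (block⊆triple xl , block⊆triple yl)

  -- Again {x , y} supplies the third triple. Together with `nested-inner-unique`, a pair of points
  -- of X is used at most once and in one direction only.
  nested-inner-asym : ∀ {x z z′ y} → Nested x z (ι y) → ¬ Nested y z′ (ι x)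
  nested-inner-asym {x} {y = y} n@(i , _ , xi , _ , φi) (j , _ , yj , _ , φj) with x ≟ y
  ... | yes refl = nested-≢ n
  ... | no  x≢y  = let l , xl , yl = through x≢y in no-three-triples (x≢y ∘ ι-injective)
    (λ { refl → φ≢ι yj φi }) (λ { refl → φ≢ι yl φi }) (λ { refl → φ≢ι xl φj })
    (block⊆triple xi , φ∈triple φi) (φ∈triple φj , block⊆triple yj) (block⊆triple xl , block⊆triple yl)

  -- All three triples would pass through `ι x` and y. For y outside X this is the degree bound 2 at
  -- a new point.
  nested-no-three : ∀ {x z z′ z″ y} → z ≢ z′ → z ≢ z″ → z′ ≢ z″ →
                    Nested x z y → Nested x z′ y → Nested x z″ y → ⊥
  nested-no-three z≢z′ z≢z″ z′≢z″ n@(_ , _ , xi , _ , φi) n′@(_ , _ , xj , _ , φj) n″@(_ , _ , xl , _ , φl) =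
    no-three-triples (φ≢ι xi ∘ trans φi ∘ sym)
      (nested-index-≢ z≢z′ n n′) (nested-index-≢ z≢z″ n n″) (nested-index-≢ z′≢z″ n′ n″)
      (block⊆triple xi , φ∈triple φi) (block⊆triple xj , φ∈triple φj) (block⊆triple xl , φ∈triple φl)

  -- At most two z are nested with x on u. The Boolean records whether a smaller one exists, which
  -- turns this bound into an injection into `Bool`.
  data Rank (x z : Fin v) (u : Fin w) : Bool → Set where
    first  : (∀ {z′} → z′ Fin.< z → ¬ Nested x z′ u) → Rank x z u false
    second : ∀ {z′} → z′ Fin.< z → Nested x z′ u → Rank x z u true

  rank : ∀ x z u → ∃ (Rank x z u)
  rank x z u with any? (λ z′ → (z′ Fin.<? z) ×-dec nested? x z′ u)
  ... | yes (_ , z′<z , n) = true , second z′<z n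
  ... | no  none           = false , first λ z′<z n → none (_ , z′<z , n)

  rank-≮ : ∀ {x z z′ u r} → z Fin.< z′ → Nested x z u → Nested x z′ u → Rank x z u r → ¬ Rank x z′ u r
  rank-≮ z<z′ n _  (first _)         (first none)  = none z<z′ n
  rank-≮ z<z′ n n′ (second z″<z n″) (second _ _) =
    nested-no-three (Fin.<⇒≢ z″<z) (Fin.<⇒≢ (Fin.<-trans z″<z z<z′)) (Fin.<⇒≢ z<z′) n″ n n′

  rank-injective : ∀ {x z z′ u r} → Nested x z u → Nested x z′ u → Rank x z u r → Rank x z′ u r → z ≡ z′
  rank-injective {z = z} {z′} n n′ ρ ρ′ with Fin.<-cmp z z′
  ... | tri< z<z′ _ _ = contradiction ρ′ (rank-≮ z<z′ n n′ ρ)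
  ... | tri≈ _ z≡z′ _ = z≡z′
  ... | tri> _ _ z′<z = contradiction ρ (rank-≮ z′<z n′ n ρ′)

  -- Two copies of every ordered pair, diagonal included, plus four copies of X × X as padding. In
  -- the target, the four copies of X × Y stand for two ranks times the two copies of a pair; the
  -- summand `Fin v` receives the second copy of the diagonal.
  Source Target : Set
  Source = (Fin v × Fin v × Bool) ⊎ (Fin v × Fin v × Bool × Bool)
  Target = (Fin v × Fin v) ⊎ Fin v ⊎ (Fin v × Fin w × Bool × Bool)

  -- A nesting into X pays with both orders of the pair {x , φ{x,z}}, which carries
  -- no other nesting; a nesting outside X pays with one of the two uses of (x , u).
  -- Padding by X × X avoids naming the complement of X in Y.
  data Charge : Source → Target → Set where
    diagonal₀ : ∀ {x} → Charge (inj₁ (x , x , false)) (inj₁ (x , x))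
    diagonal₁ : ∀ {x} → Charge (inj₁ (x , x , true)) (inj₂ (inj₁ x))
    inner₀    : ∀ {x y z} → Nested x z (ι y) → Charge (inj₁ (x , z , false)) (inj₁ (x , y))
    inner₁    : ∀ {x y z} → Nested x z (ι y) → Charge (inj₁ (x , z , true)) (inj₁ (y , x))
    outer     : ∀ {x z u b r} → Nested x z u → (∀ y → ι y ≢ u) → Rank x z u r →
                Charge (inj₁ (x , z , b)) (inj₂ (inj₂ (x , u , r , b)))
    padding   : ∀ {x y u b c} → ι y ≡ u → Charge (inj₂ (x , y , b , c)) (inj₂ (inj₂ (x , u , b , c)))

  charge : ∀ s → ∃ (Charge s)
  charge (inj₂ _) = _ , padding refl
  charge (inj₁ (x , z , b)) with x ≟ z
  charge (inj₁ (x , z , false)) | yes refl = _ , diagonal₀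
  charge (inj₁ (x , z , true))  | yes refl = _ , diagonal₁
  charge (inj₁ (x , z , b))     | no x≢z with nested-exists x≢z
  ... | u , n with any? (λ y → ι y ≟ u)
  charge (inj₁ (x , z , false)) | no _ | _ , n | yes (_ , refl) = _ , inner₀ n
  charge (inj₁ (x , z , true))  | no _ | _ , n | yes (_ , refl) = _ , inner₁ n
  charge (inj₁ (x , z , b))     | no _ | u , n | no ∉ι =
    _ , outer n (λ y eq → ∉ι (y , eq)) (proj₂ (rank x z u))

  -- An inner charge meeting a diagonal one would nest a block on its own point; `inner₀` meeting
  -- `inner₁` would use one pair in both directions; `outer` and `padding` stay apart because u lies
  -- outside X for one and inside for the other.
  charge-injective : ∀ {s s′ t} → Charge s t → Charge s′ t → s ≡ s′
  charge-injective diagonal₀ diagonal₀ = refl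
  charge-injective diagonal₀ (inner₀ n) = contradiction n nested-≢
  charge-injective diagonal₀ (inner₁ n) = contradiction n nested-≢
  charge-injective diagonal₁ diagonal₁ = refl
  charge-injective (inner₀ n) diagonal₀ = contradiction n nested-≢
  charge-injective (inner₀ n) (inner₀ n′) with refl ← nested-inner-unique n n′ = refl
  charge-injective (inner₀ n) (inner₁ n′) = contradiction n′ (nested-inner-asym n)
  charge-injective (inner₁ n) diagonal₀ = contradiction n nested-≢
  charge-injective (inner₁ n) (inner₀ n′) = contradiction n′ (nested-inner-asym n)
  charge-injective (inner₁ n) (inner₁ n′) with refl ← nested-inner-unique n n′ = refl
  charge-injective (outer n _ ρ) (outer n′ _ ρ′) with refl ← rank-injective n n′ ρ ρ′ = refl
  charge-injective (outer _ ∉ι _) (padding eq) = contradiction eq (∉ι _)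
  charge-injective (padding eq) (outer _ ∉ι _) = contradiction eq (∉ι _)
  charge-injective (padding refl) (padding eq) with refl ← ι-injective eq = refl

  private
    infixr 2 _⊗_
    infixr 1 _⊕_
    _⊗_ : ∀ {a b} {A B : Set} → Fin a ↔ A → Fin b ↔ B → Fin (a * b) ↔ (A × B)
    f ⊗ g = (f ×-↔ g) ↔-∘ *↔×
    _⊕_ : ∀ {a b} {A B : Set} → Fin a ↔ A → Fin b ↔ B → Fin (a + b) ↔ (A ⊎ B)
    f ⊕ g = (f ⊎-↔ g) ↔-∘ +↔⊎

    X : Fin v ↔ Fin v
    X = ↔-id _

    #Source : Fin (v * (v * 2) + v * (v * (2 * 2))) ↔ Source
    #Source = (X ⊗ X ⊗ 2↔Bool) ⊕ (X ⊗ X ⊗ 2↔Bool ⊗ 2↔Bool)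

    #Target : Fin (v * v + (v + v * (w * (2 * 2)))) ↔ Target
    #Target = (X ⊗ X) ⊕ X ⊕ (X ⊗ ↔-id _ ⊗ 2↔Bool ⊗ 2↔Bool)

  source≤target : v * (v * 2) + v * (v * (2 * 2)) ≤ v * v + (v + v * (w * (2 * 2)))
  source≤target = injective⇒≤ {f = from #Target ∘ proj₁ ∘ charge ∘ to #Source} λ {i} {j} eq →
    let s , t = to #Source i , to #Source j in
    ↔-injective #Source (charge-injective (proj₂ (charge s))
      (subst (Charge t) (sym (↔-injective (↔-sym #Target) eq)) (proj₂ (charge t))))
    where
    open Inverse using (to; from)
    ↔-injective : {A B : Set} (f : A ↔ B) → Injective _≡_ _≡_ (to f)
    ↔-injective f = Injection.injective (↔⇒↣ f)

  5v≤1+4w : 1 ≤ v → 5 * v ≤ 1 + 4 * w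
  -- `source≤target` reads 6v² ≤ v² + v + 4vw; v² is subtracted on both sides and the positive
  -- factor v cancelled.
  5v≤1+4w (s≤s z≤n) = ℕ.*-cancelˡ-≤ v (ℕ.+-cancelˡ-≤ (v * v) _ _
    (subst₂ _≤_ (source-size v) (target-size v w) source≤target))
    where
    source-size : ∀ v → v * (v * 2) + v * (v * (2 * 2)) ≡ v * v + v * (5 * v)
    source-size = solve-∀
    target-size : ∀ v w → v * v + (v + v * (w * (2 * 2))) ≡ v * v + v * (1 + 4 * w)
    target-size = solve-∀

  bound : 1 ≤ v → ⌈ (5 * v ∸ 1) / 4 ⌉ ≤ w
  -- The ceiling is `(5 * v ∸ 1 + 3) / 4`, so it is at most w once its numerator is below 4(w + 1).
  bound 1≤v = ℕ.≤-pred (m<n*o⇒m/o<n {n = suc w} {o = 4} (begin-strict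
    5 * v ∸ 1 + 3   ≤⟨ ℕ.+-monoˡ-≤ 3 (ℕ.∸-monoˡ-≤ 1 (5v≤1+4w 1≤v)) ⟩
    4 * w + 3       <⟨ ℕ.n<1+n _ ⟩
    suc (4 * w + 3) ≡⟨ rearrange w ⟩
    suc w * 4       ∎))
    where
    open ℕ.≤-Reasoning
    rearrange : ∀ w → suc (4 * w + 3) ≡ suc w * 4
    rearrange = solve-∀

-- A code is a 2-subset {tail , head} together with its image under φ, in X or among
-- r new points. Orienting the 2-subsets so that every point is at most once a tail and
-- at most once a head for a given new point is what bounds their degree by 2.
record Scheme (v r : ℕ) : Set₁ where
  field
    Code      : Set
    tail head : Code → Fin v
    apex      : Code → Fin v ⊎ Fin r

  _on_ : Fin v → Code → Set
  x on c = x ≡ tail c ⊎ x ≡ head c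

  field
    cover        : ∀ {x y} → x ≢ y → ∃[ c ] x on c × y on c
    apex-off     : ∀ {c x} → apex c ≡ inj₁ x → ¬ x on c
    inner-unique : ∀ {c c′ x y} → apex c ≡ inj₁ y → apex c′ ≡ inj₁ y → x on c → x on c′ → c ≡ c′
    inner-asym   : ∀ {c c′ x y} → apex c ≡ inj₁ y → x on c → apex c′ ≡ inj₁ x → ¬ y on c′
    tail-unique  : ∀ {c c′ u} → apex c ≡ inj₂ u → apex c′ ≡ inj₂ u → tail c ≡ tail c′ → c ≡ c′
    head-unique  : ∀ {c c′ u} → apex c ≡ inj₂ u → apex c′ ≡ inj₂ u → head c ≡ head c′ → c ≡ c′

  on-exhausted : ∀ {c x y z} → x ≢ y → x on c → y on c → z on c → z ≡ x ⊎ z ≡ y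
  on-exhausted x≢y (inj₁ refl) (inj₁ refl) _           = contradiction refl x≢y
  on-exhausted x≢y (inj₁ refl) (inj₂ refl) z-on        = z-on
  on-exhausted x≢y (inj₂ refl) (inj₁ refl) (inj₁ refl) = inj₂ refl
  on-exhausted x≢y (inj₂ refl) (inj₁ refl) (inj₂ refl) = inj₁ refl
  on-exhausted x≢y (inj₂ refl) (inj₂ refl) _           = contradiction refl x≢y

-- From a scheme to a weak nesting on v + r points.

module Realize {v r} (S : Scheme v r) (𝒟 : BIBD v 2 1) where
  open Scheme S
  open Pairs 𝒟

  private
    module Points i = Doubleton (doubleton {A = block i} (size i))

    covering : ∀ i → ∃[ c ] Points.fst i on c × Points.snd i on c
    covering i = cover (Points.fst≢snd i)

  -- A 2-subset may have several codes, so one is chosen for each block. The choice is injective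
  -- because a code determines its two points, and these determine the block.
  code : Fin blockCount → Code
  code i = proj₁ (covering i)

  ∈⇒on : ∀ {i x} → x ∈ block i → x on code i
  ∈⇒on {i} x∈ with Points.exhausted i x∈
  ... | inj₁ refl = proj₁ (proj₂ (covering i))
  ... | inj₂ refl = proj₂ (proj₂ (covering i))

  on⇒∈ : ∀ {i x} → x on code i → x ∈ block i
  on⇒∈ {i} x-on with on-exhausted (Points.fst≢snd i) (proj₁ (proj₂ (covering i))) (proj₂ (proj₂ (covering i))) x-on
  ... | inj₁ refl = Points.fst∈ i
  ... | inj₂ refl = Points.snd∈ i

  code-injective : Injective _≡_ _≡_ code
  code-injective {i} {j} eq = unique-block (Points.fst≢snd i) (Points.fst∈ i) (Points.snd∈ i)
    (on⇒∈ (subst (_ on_) eq (∈⇒on (Points.fst∈ i)))) (on⇒∈ (subst (_ on_) eq (∈⇒on (Points.snd∈ i))))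

  ι : Fin v → Fin (v + r)
  ι = _↑ˡ r

  ι-injective : Injective _≡_ _≡_ ι
  ι-injective = Fin.↑ˡ-injective r _ _

  φ : Fin blockCount → Fin (v + r)
  φ = join v r ∘ apex ∘ code

  apex-code : ∀ {i s} → φ i ≡ join v r s → apex (code i) ≡ s
  apex-code {s = s} eq = trans (sym (Fin.splitAt-join v r _)) (trans (cong (splitAt v) eq) (Fin.splitAt-join v r s))

  base : Fin blockCount → Subset (v + r)
  base i = image ι (block i)

  triple : Fin blockCount → Subset (v + r)
  triple i = base i ∪ ⁅ φ i ⁆

  ∈base⇒∈block : ∀ {i s} → join v r s ∈ base i → ∃[ x ] s ≡ inj₁ x × x ∈ block i
  ∈base⇒∈block {s = s} s∈ with ∈-image⁻ ι s∈
  ... | x , x∈ , eq = x , trans (sym (Fin.splitAt-join v r s))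
                                (trans (cong (splitAt v) (sym eq)) (Fin.splitAt-↑ˡ v x r)) , x∈

  φ∉base : ∀ i → φ i ∉ base i
  φ∉base i φ∈ = let x , eq , x∈ = ∈base⇒∈block φ∈ in apex-off eq (∈⇒on x∈)

  inner : ∀ {i x} → ι x ∈ triple i → x ∈ block i ⊎ apex (code i) ≡ inj₁ x
  inner {i} {x} x∈ with x∈p∪q⁻ (base i) _ x∈
  ... | inj₁ x∈base with _ , refl , x∈block ← ∈base⇒∈block {s = inj₁ x} x∈base = inj₁ x∈block
  ... | inj₂ x≡φ = inj₂ (apex-code (sym (x∈⁅y⁆⇒x≡y _ x≡φ)))

  outer : ∀ {i u} → v ↑ʳ u ∈ triple i → apex (code i) ≡ inj₂ u
  outer {i} {u} u∈ with x∈p∪q⁻ (base i) _ u∈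
  ... | inj₁ u∈base with _ , () , _ ← ∈base⇒∈block {s = inj₂ u} u∈base
  ... | inj₂ u≡φ = apex-code (sym (x∈⁅y⁆⇒x≡y _ u≡φ))

  colour : ∀ {P : Pred (Fin blockCount) 0ℓ} → Decidable P → Fin blockCount → Fin 2
  colour P? i with P? i
  ... | yes _ = zero
  ... | no  _ = suc zero

  colour-injective : ∀ {P Q : Pred (Fin blockCount) 0ℓ} (P? : Decidable P) →
    (∀ {i j} → Q i → Q j → P i → P j → i ≡ j) → (∀ {i j} → Q i → Q j → ¬ P i → ¬ P j → i ≡ j) →
    ∀ i j → Q i → Q j → colour P? i ≡ colour P? j → i ≡ j
  colour-injective P? pos neg i j qi qj eq with P? i | P? j
  ... | yes pi | yes pj = pos qi qj pi pj
  ... | no ¬pi | no ¬pj = neg qi qj ¬pi ¬pj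

  -- A bound of two in the form that `count-≤` takes: the triples through p and q fall into two
  -- classes with at most one triple each.
  TwoColoured : Fin (v + r) → Fin (v + r) → Set
  TwoColoured p q = Σ[ c ∈ (Fin blockCount → Fin 2) ] ∀ i j →
    p ∈ triple i × q ∈ triple i → p ∈ triple j × q ∈ triple j → c i ≡ c j → i ≡ j

  swapped : ∀ {p q} → TwoColoured p q → TwoColoured q p
  swapped (c , inj) = c , λ i j qi qj → inj i j (swap qi) (swap qj)

  -- One class is the block {x , y} itself. In the other, x is nested on y or y on x, and
  -- `inner-unique` and `inner-asym` leave at most one such triple.
  inner-inner : ∀ {x y} → x ≢ y → TwoColoured (ι x) (ι y)
  inner-inner {x} {y} x≢y = colour both , colour-injective both
    (λ _ _ (xi , yi) (xj , yj) → unique-block x≢y xi yi xj yj)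
    (λ (xi , yi) (xj , yj) ¬bi ¬bj → code-injective (nested ¬bi ¬bj (inner xi) (inner yi) (inner xj) (inner yj)))
    where
    both : Decidable (λ i → x ∈ block i × y ∈ block i)
    both i = both? x y (block i)

    same-apex : ∀ {i} {s t : Fin v ⊎ Fin r} → apex (code i) ≡ s → apex (code i) ≡ t → s ≡ t
    same-apex p q = trans (sym p) q

    nested : ∀ {i j} → ¬ (x ∈ block i × y ∈ block i) → ¬ (x ∈ block j × y ∈ block j) →
             x ∈ block i ⊎ apex (code i) ≡ inj₁ x → y ∈ block i ⊎ apex (code i) ≡ inj₁ y →
             x ∈ block j ⊎ apex (code j) ≡ inj₁ x → y ∈ block j ⊎ apex (code j) ≡ inj₁ y → code i ≡ code j
    nested ¬bi ¬bj (inj₁ xi) (inj₁ yi) _ _ = contradiction (xi , yi) ¬bi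
    nested ¬bi ¬bj _ _ (inj₁ xj) (inj₁ yj) = contradiction (xj , yj) ¬bj
    nested ¬bi ¬bj (inj₂ xi) (inj₂ yi) _ _ with refl ← same-apex xi yi = contradiction refl x≢y
    nested ¬bi ¬bj _ _ (inj₂ xj) (inj₂ yj) with refl ← same-apex xj yj = contradiction refl x≢y
    nested ¬bi ¬bj (inj₁ xi) (inj₂ yi) (inj₁ xj) (inj₂ yj) = inner-unique yi yj (∈⇒on xi) (∈⇒on xj)
    nested ¬bi ¬bj (inj₂ xi) (inj₁ yi) (inj₂ xj) (inj₁ yj) = inner-unique xi xj (∈⇒on yi) (∈⇒on yj)
    nested ¬bi ¬bj (inj₁ xi) (inj₂ yi) (inj₂ xj) (inj₁ yj) = contradiction (∈⇒on yj) (inner-asym yi (∈⇒on xi) xj)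
    nested ¬bi ¬bj (inj₂ xi) (inj₁ yi) (inj₁ xj) (inj₂ yj) = contradiction (∈⇒on xj) (inner-asym xi (∈⇒on yi) yj)

  -- The classes are the codes with x as tail and those with x as head.
  inner-outer : ∀ x u → TwoColoured (ι x) (v ↑ʳ u)
  inner-outer x u = colour tail? , colour-injective tail?
    (λ (_ , ui) (_ , uj) ti tj → code-injective (tail-unique (outer ui) (outer uj) (trans (sym ti) tj)))
    (λ (xi , ui) (xj , uj) ¬ti ¬tj → code-injective (head-unique (outer ui) (outer uj)
      (trans (sym (is-head (outer ui) ¬ti (inner xi))) (is-head (outer uj) ¬tj (inner xj)))))
    where
    tail? : Decidable (λ i → x ≡ tail (code i))
    tail? i = x ≟ tail (code i)

    is-head : ∀ {i} → apex (code i) ≡ inj₂ u → x ≢ tail (code i) →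
              x ∈ block i ⊎ apex (code i) ≡ inj₁ x → x ≡ head (code i)
    is-head a ¬t (inj₁ x∈) with ∈⇒on x∈
    ... | inj₁ t = contradiction t ¬t
    ... | inj₂ h = h
    is-head a ¬t (inj₂ a′) with () ← trans (sym a) a′

  -- A triple has only its apex outside X, so none contains two new points.
  outer-outer : ∀ {u u′} → u ≢ u′ → TwoColoured (v ↑ʳ u) (v ↑ʳ u′)
  outer-outer u≢u′ = (λ _ → zero) , λ i j (ui , u′i) _ _ →
    contradiction (inj₂-injective (trans (sym (outer ui)) (outer u′i))) u≢u′

  twoColoured : ∀ s t → join v r s ≢ join v r t → TwoColoured (join v r s) (join v r t)
  twoColoured (inj₁ x) (inj₁ y)  s≢t = inner-inner (s≢t ∘ cong ι)
  twoColoured (inj₁ x) (inj₂ u)  s≢t = inner-outer x u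
  twoColoured (inj₂ u) (inj₁ x)  s≢t = swapped (inner-outer x u)
  twoColoured (inj₂ u) (inj₂ u′) s≢t = outer-outer (s≢t ∘ cong (v ↑ʳ_))

  packed : ∀ {p q} → p ≢ q → pairCount (tabulate triple) p q ≤ 2
  packed {p} {q} p≢q = count-≤ (λ A → (p ∈? A) ×-dec (q ∈? A)) (tabulate triple) (proj₁ coloured)
    λ i j pqi pqj → proj₂ coloured i j (at i pqi) (at j pqj)
    where
    coloured : TwoColoured p q
    coloured = subst₂ TwoColoured (Fin.join-splitAt v r p) (Fin.join-splitAt v r q)
      (twoColoured (splitAt v p) (splitAt v q)
        (subst₂ _≢_ (sym (Fin.join-splitAt v r p)) (sym (Fin.join-splitAt v r q)) p≢q))
    at : ∀ i → p ∈ lookup (tabulate triple) i × q ∈ lookup (tabulate triple) i → p ∈ triple i × q ∈ triple i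
    at i = subst (λ A → p ∈ A × q ∈ A) (lookup∘tabulate triple i)

  weakNesting : WeakNesting 𝒟 (v + r)
  weakNesting = record
    { ι = mk↣ ι-injective
    ; φ = φ
    ; φ∉block = φ∉base
    ; partial = record
      { block-size = All.tabulate⁺ λ i → trans (∣p∪⁅x⁆∣≡1+∣p∣ (φ∉base i)) (cong suc (∣image∣≡2 ι ι-injective (size i)))
      ; packed = packed
      }
    }

-- Arithmetic of ℤ/V on `Fin V`.

module Cyclic (V : ℕ) .{{_ : NonZero V}} where

  infixl 6 _⊕_ _⊖_

  _⊕_ : Fin V → ℕ → Fin V
  x ⊕ a = (toℕ x + a) mod V

  -- Since V ≥ 1, `a * V ∸ a` never truncates, so it represents -a for every a, even beyond V.
  _⊖_ : Fin V → ℕ → Fin V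
  x ⊖ a = x ⊕ (a * V ∸ a)

  toℕ-mod : ∀ m → toℕ (m mod V) ≡ m % V
  toℕ-mod m = toℕ-fromℕ< (m%n<n m V)

  [m%V+n]%V≡[m+n]%V : ∀ m n → (m % V + n) % V ≡ (m + n) % V
  [m%V+n]%V≡[m+n]%V m n = begin
    (m % V + n) % V           ≡⟨ %-distribˡ-+ (m % V) n V ⟩
    (m % V % V + n % V) % V   ≡⟨ cong (λ l → (l + n % V) % V) (m%n%n≡m%n m V) ⟩
    (m % V + n % V) % V       ≡⟨ %-distribˡ-+ m n V ⟨
    (m + n) % V               ∎
    where open ≡-Reasoning

  toℕ-⊕-⊕ : ∀ x a b → toℕ (x ⊕ a ⊕ b) ≡ (toℕ x + a + b) % V
  toℕ-⊕-⊕ x a b = begin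
    toℕ (x ⊕ a ⊕ b)             ≡⟨ toℕ-mod (toℕ (x ⊕ a) + b) ⟩
    (toℕ (x ⊕ a) + b) % V       ≡⟨ cong (λ l → (l + b) % V) (toℕ-mod (toℕ x + a)) ⟩
    ((toℕ x + a) % V + b) % V   ≡⟨ [m%V+n]%V≡[m+n]%V (toℕ x + a) b ⟩
    (toℕ x + a + b) % V         ∎
    where open ≡-Reasoning

  ⊕-assoc : ∀ x a b → x ⊕ a ⊕ b ≡ x ⊕ (a + b)
  ⊕-assoc x a b = toℕ-injective (begin
    toℕ (x ⊕ a ⊕ b)         ≡⟨ toℕ-⊕-⊕ x a b ⟩
    (toℕ x + a + b) % V     ≡⟨ cong (_% V) (ℕ.+-assoc (toℕ x) a b) ⟩
    (toℕ x + (a + b)) % V   ≡⟨ toℕ-mod (toℕ x + (a + b)) ⟨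
    toℕ (x ⊕ (a + b))       ∎)
    where open ≡-Reasoning

  ⊕-* : ∀ x a → x ⊕ a * V ≡ x
  ⊕-* x a = toℕ-injective (begin
    toℕ (x ⊕ a * V)       ≡⟨ toℕ-mod (toℕ x + a * V) ⟩
    (toℕ x + a * V) % V   ≡⟨ [m+kn]%n≡m%n (toℕ x) a V ⟩
    toℕ x % V             ≡⟨ m<n⇒m%n≡m (toℕ<n x) ⟩
    toℕ x                 ∎)
    where open ≡-Reasoning

  ⊕-⊖ : ∀ x a → x ⊕ a ⊖ a ≡ x
  ⊕-⊖ x a = begin
    x ⊕ a ⊖ a               ≡⟨ ⊕-assoc x a (a * V ∸ a) ⟩
    x ⊕ (a + (a * V ∸ a))   ≡⟨ cong (x ⊕_) (ℕ.m+[n∸m]≡n (ℕ.m≤m*n a V)) ⟩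
    x ⊕ a * V               ≡⟨ ⊕-* x a ⟩
    x                       ∎
    where open ≡-Reasoning

  ⊖-⊕ : ∀ x a → x ⊖ a ⊕ a ≡ x
  ⊖-⊕ x a = begin
    x ⊖ a ⊕ a               ≡⟨ ⊕-assoc x (a * V ∸ a) a ⟩
    x ⊕ (a * V ∸ a + a)     ≡⟨ cong (x ⊕_) (ℕ.m∸n+n≡m (ℕ.m≤m*n a V)) ⟩
    x ⊕ a * V               ≡⟨ ⊕-* x a ⟩
    x                       ∎
    where open ≡-Reasoning

  ⊕-cancelʳ : ∀ a {x y} → x ⊕ a ≡ y ⊕ a → x ≡ y
  ⊕-cancelʳ a {x} {y} eq = trans (sym (⊕-⊖ x a)) (trans (cong (_⊖ a) eq) (⊕-⊖ y a))

  -- Adding V - x undoes the shift by x, so a is read off as a residue; left cancellation follows.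
  toℕ-rotate : ∀ x {a} → a < V → toℕ (x ⊕ a ⊕ (V ∸ toℕ x)) ≡ a
  toℕ-rotate x {a} a<V = begin
    toℕ (x ⊕ a ⊕ (V ∸ toℕ x))         ≡⟨ toℕ-⊕-⊕ x a (V ∸ toℕ x) ⟩
    (toℕ x + a + (V ∸ toℕ x)) % V     ≡⟨ cong (λ l → (l + (V ∸ toℕ x)) % V) (ℕ.+-comm (toℕ x) a) ⟩
    (a + toℕ x + (V ∸ toℕ x)) % V     ≡⟨ cong (_% V) (ℕ.+-assoc a (toℕ x) (V ∸ toℕ x)) ⟩
    (a + (toℕ x + (V ∸ toℕ x))) % V   ≡⟨ cong (λ l → (a + l) % V) (ℕ.m+[n∸m]≡n (ℕ.<⇒≤ (toℕ<n x))) ⟩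
    (a + V) % V                       ≡⟨ [m+n]%n≡m%n a V ⟩
    a % V                             ≡⟨ m<n⇒m%n≡m a<V ⟩
    a                                 ∎
    where open ≡-Reasoning

  ⊕-cancelˡ : ∀ x {a b} → a < V → b < V → x ⊕ a ≡ x ⊕ b → a ≡ b
  ⊕-cancelˡ x a<V b<V eq = trans (sym (toℕ-rotate x a<V))
    (trans (cong (λ y → toℕ (y ⊕ (V ∸ toℕ x))) eq) (toℕ-rotate x b<V))

  ⊕-0 : ∀ x → x ⊕ 0 ≡ x
  ⊕-0 x = ⊕-* x 0

  ⊕-V : ∀ x → x ⊕ V ≡ x
  ⊕-V x = trans (cong (x ⊕_) (sym (ℕ.*-identityˡ V))) (⊕-* x 1)

  ⊕-≢ : ∀ x {a} → 0 < a → a < V → x ⊕ a ≢ x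
  ⊕-≢ x 0<a a<V eq = ℕ.<⇒≢ 0<a (sym (⊕-cancelˡ x a<V (ℕ.≤-<-trans z≤n a<V) (trans eq (sym (⊕-0 x)))))

  difference : ∀ x y → ∃[ e ] e < V × x ⊕ e ≡ y
  difference x y = toℕ z , toℕ<n z , toℕ-injective (begin
    toℕ (x ⊕ toℕ z)                       ≡⟨ toℕ-mod (toℕ x + toℕ z) ⟩
    (toℕ x + toℕ z) % V                   ≡⟨ cong (_% V) (ℕ.+-comm (toℕ x) (toℕ z)) ⟩
    (toℕ z + toℕ x) % V                   ≡⟨ toℕ-mod (toℕ z + toℕ x) ⟨
    toℕ (z ⊕ toℕ x)                       ≡⟨ cong toℕ (⊕-assoc y (V ∸ toℕ x) (toℕ x)) ⟩
    toℕ (y ⊕ (V ∸ toℕ x + toℕ x))         ≡⟨ cong (λ l → toℕ (y ⊕ l)) (ℕ.m∸n+n≡m (ℕ.<⇒≤ (toℕ<n x))) ⟩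
    toℕ (y ⊕ V)                           ≡⟨ cong toℕ (⊕-V y) ⟩
    toℕ y                                 ∎)
    where
    open ≡-Reasoning
    z = y ⊕ (V ∸ toℕ x)

  Separated : Fin V → Fin V → Set
  Separated x y = ∃[ e ] 0 < e × e + e ≤ V × x ⊕ e ≡ y

  -- Of the differences e and V - e between two points, taken in the two directions, one is at most
  -- V/2.
  separated : ∀ {x y} → x ≢ y → Separated x y ⊎ Separated y x
  separated {x} {y} x≢y with difference x y
  ... | zero  , _ , eq = contradiction (trans (sym (⊕-0 x)) eq) x≢y
  ... | e@(suc _) , e<V , eq with ℕ.≤-total (e + e) V
  ...   | inj₁ 2e≤V = inj₁ (e , z<s , 2e≤V , eq)
  ...   | inj₂ V≤2e = inj₂ (V ∸ e , ℕ.m<n⇒0<n∸m e<V , short , (begin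
    y ⊕ (V ∸ e)         ≡⟨ cong (_⊕ (V ∸ e)) eq ⟨
    x ⊕ e ⊕ (V ∸ e)     ≡⟨ ⊕-assoc x e (V ∸ e) ⟩
    x ⊕ (e + (V ∸ e))   ≡⟨ cong (x ⊕_) (ℕ.m+[n∸m]≡n (ℕ.<⇒≤ e<V)) ⟩
    x ⊕ V               ≡⟨ ⊕-V x ⟩
    x                   ∎))
    where
    open ≡-Reasoning
    short : V ∸ e + (V ∸ e) ≤ V
    short = subst (V ∸ e + (V ∸ e) ≤_) (ℕ.m+[n∸m]≡n (ℕ.<⇒≤ e<V)) (ℕ.+-monoˡ-≤ (V ∸ e) (ℕ.m≤n+o⇒m∸n≤o V e V≤2e))

-- The points are ℤ/V and at most one fixed hub. Around each apex y the pairs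
-- {y + k − j , y + k + 1 + j} and {hub , y + 2k + 1} are nested on y; their differences
-- 2j + 1 exhaust the odd numbers below 2k. No two offsets used here add up to V, so
-- x is never nested on y while y is nested on x. The pairs {t , t + span j} with one
-- of the r remaining differences all go to the j-th new point.
module CyclicScheme
  (V h k r : ℕ) .{{_ : NonZero V}}
  (h≤1 : h ≤ 1)
  (room : (k + k + h) + (k + k + h) < V)
  (span : Fin r → ℕ)
  (every-span : ∀ {e} → 0 < e → e + e ≤ V →
                (∃[ j ] e ≡ suc (toℕ {k} j + toℕ j)) ⊎ (∃[ j ] e ≡ span j))
  where
  open Cyclic V

  -- The offsets around an apex run once through 1, ..., 2k + h: `lo` descends from k to 1, `hi`
  -- ascends from k + 1 to 2k, and `over` is 2k + 1, the partner of the hub.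
  data Rim : Set where
    lo hi : Fin k → Rim
    over  : Fin h → Rim

  offset : Rim → ℕ
  offset (lo j)   = k ∸ toℕ j
  offset (hi j)   = suc (k + toℕ j)
  offset (over z) = suc (k + k + toℕ z)

  lo≤k : ∀ j → offset (lo j) ≤ k
  lo≤k j = ℕ.m∸n≤m k (toℕ j)

  hi≤k+k : ∀ j → offset (hi j) ≤ k + k
  hi≤k+k j = ℕ.+-monoʳ-< k (toℕ<n j)

  lo<hi : ∀ i j → offset (lo i) < offset (hi j)
  lo<hi i j = s≤s (ℕ.≤-trans (lo≤k i) (ℕ.m≤m+n k (toℕ j)))

  lo<over : ∀ i z → offset (lo i) < offset (over z)
  lo<over i z = s≤s (ℕ.≤-trans (lo≤k i) (ℕ.≤-trans (ℕ.m≤m+n k k) (ℕ.m≤m+n (k + k) (toℕ z))))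

  hi<over : ∀ i z → offset (hi i) < offset (over z)
  hi<over i z = s≤s (ℕ.≤-trans (hi≤k+k i) (ℕ.m≤m+n (k + k) (toℕ z)))

  offset-injective : Injective _≡_ _≡_ offset
  offset-injective {lo i} {lo j} eq =
    cong lo (toℕ-injective (ℕ.∸-cancelˡ-≡ (ℕ.<⇒≤ (toℕ<n i)) (ℕ.<⇒≤ (toℕ<n j)) eq))
  offset-injective {lo i} {hi j} eq = contradiction eq (ℕ.<⇒≢ (lo<hi i j))
  offset-injective {lo i} {over z} eq = contradiction eq (ℕ.<⇒≢ (lo<over i z))
  offset-injective {hi i} {lo j} eq = contradiction (sym eq) (ℕ.<⇒≢ (lo<hi j i))
  offset-injective {hi i} {hi j} eq = cong hi (toℕ-injective (ℕ.+-cancelˡ-≡ (suc k) _ _ eq))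
  offset-injective {hi i} {over z} eq = contradiction eq (ℕ.<⇒≢ (hi<over i z))
  offset-injective {over z} {lo j} eq = contradiction (sym eq) (ℕ.<⇒≢ (lo<over j z))
  offset-injective {over z} {hi j} eq = contradiction (sym eq) (ℕ.<⇒≢ (hi<over j z))
  offset-injective {over z} {over z′} eq = cong over (toℕ-injective (ℕ.+-cancelˡ-≡ (suc (k + k)) _ _ eq))

  0<offset : ∀ o → 0 < offset o
  0<offset (lo j)   = ℕ.m<n⇒0<n∸m (toℕ<n j)
  0<offset (hi j)   = z<s
  0<offset (over z) = z<s

  offset≤ : ∀ o → offset o ≤ k + k + h
  offset≤ (lo j)   = ℕ.≤-trans (lo≤k j) (ℕ.≤-trans (ℕ.m≤m+n k k) (ℕ.m≤m+n (k + k) h))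
  offset≤ (hi j)   = ℕ.≤-trans (hi≤k+k j) (ℕ.m≤m+n (k + k) h)
  offset≤ (over z) = ℕ.+-monoʳ-< (k + k) (toℕ<n z)

  offset+offset<V : ∀ o o′ → offset o + offset o′ < V
  offset+offset<V o o′ = ℕ.≤-<-trans (ℕ.+-mono-≤ (offset≤ o) (offset≤ o′)) room

  offset<V : ∀ o → offset o < V
  offset<V o = ℕ.≤-<-trans (ℕ.m≤m+n _ _) (offset+offset<V o o)

  data Code : Set where
    inner : Fin V → Fin k → Code
    spoke : Fin V → Fin h → Code
    outer : Fin V → Fin r → Code

  hub : Fin h → Fin (h + V)
  hub z = z ↑ˡ V

  point : Fin V → Fin (h + V)
  point x = h ↑ʳ x

  point-injective : Injective _≡_ _≡_ point
  point-injective = Fin.↑ʳ-injective h _ _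

  hub≢point : ∀ {z x} → hub z ≢ point x
  hub≢point {z} {x} eq with () ←
    trans (sym (Fin.splitAt-↑ˡ h z V)) (trans (cong (splitAt h) eq) (Fin.splitAt-↑ʳ h V x))

  tail head : Code → Fin (h + V)
  tail (inner y j) = point (y ⊕ offset (lo j))
  tail (spoke y z) = hub z
  tail (outer t j) = point t
  head (inner y j) = point (y ⊕ offset (hi j))
  head (spoke y z) = point (y ⊕ offset (over z))
  head (outer t j) = point (t ⊕ span j)

  apex : Code → Fin (h + V) ⊎ Fin r
  apex (inner y j) = inj₁ (point y)
  apex (spoke y z) = inj₁ (point y)
  apex (outer t j) = inj₂ j

  -- The positions around an apex that an inner pair can occupy. Each belongs to exactly one pair,
  -- its `owner`, so a point together with the apex determines the code.
  data Slot : Set where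
    hubSlot : Fin h → Slot
    rimSlot : Rim → Slot

  place : Fin V → Slot → Fin (h + V)
  place y (hubSlot z) = hub z
  place y (rimSlot o) = point (y ⊕ offset o)

  place-injective : ∀ y → Injective _≡_ _≡_ (place y)
  place-injective y {hubSlot z} {hubSlot z′} eq = cong hubSlot (Fin.↑ˡ-injective V z z′ eq)
  place-injective y {hubSlot z} {rimSlot o} eq = contradiction eq hub≢point
  place-injective y {rimSlot o} {hubSlot z} eq = contradiction (sym eq) hub≢point
  place-injective y {rimSlot o} {rimSlot o′} eq =
    cong rimSlot (offset-injective (⊕-cancelˡ y (offset<V o) (offset<V o′) (point-injective eq)))

  owner : Fin V → Slot → Code
  owner y (hubSlot z)        = spoke y z
  owner y (rimSlot (lo j))   = inner y j
  owner y (rimSlot (hi j))   = inner y j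
  owner y (rimSlot (over z)) = spoke y z

  -- Packs "c has apex y and x lies on c" into one slot, so that `inner-unique` becomes injectivity
  -- of `place y`.
  data InnerView : Code → Fin (h + V) → Fin (h + V) → Set where
    slot : ∀ y s → InnerView (owner y s) (point y) (place y s)

  innerView : ∀ c {x y} → apex c ≡ inj₁ y → x ≡ tail c ⊎ x ≡ head c → InnerView c y x
  innerView (inner y j) refl (inj₁ refl) = slot y (rimSlot (lo j))
  innerView (inner y j) refl (inj₂ refl) = slot y (rimSlot (hi j))
  innerView (spoke y z) refl (inj₁ refl) = slot y (hubSlot z)
  innerView (spoke y z) refl (inj₂ refl) = slot y (rimSlot (over z))

  view-unique : ∀ {c c′ x x′ y y′} → InnerView c y x → InnerView c′ y′ x′ → y ≡ y′ → x ≡ x′ → c ≡ c′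
  view-unique (slot y s) (slot y′ s′) y≡y′ x≡x′ with refl ← point-injective y≡y′ =
    cong (owner y) (place-injective y x≡x′)

  -- The offsets from y to x and back would add up to 0 modulo V, but their sum lies strictly
  -- between 0 and V. The hub is never an apex.
  view-asym : ∀ {c c′ x x′ y y′} → InnerView c y x → InnerView c′ x′ y′ → y ≡ y′ → x ≡ x′ → ⊥
  view-asym (slot y (hubSlot z)) (slot _ _) _ eq = hub≢point eq
  view-asym (slot y (rimSlot o)) (slot _ (hubSlot z)) eq _ = hub≢point (sym eq)
  view-asym (slot y (rimSlot o)) (slot x (rimSlot o′)) y≡ x≡ =
    ⊕-≢ y (ℕ.<-≤-trans (0<offset o) (ℕ.m≤m+n _ _)) (offset+offset<V o o′) (begin
      y ⊕ (offset o + offset o′)  ≡⟨ ⊕-assoc y (offset o) (offset o′) ⟨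
      y ⊕ offset o ⊕ offset o′    ≡⟨ cong (_⊕ offset o′) (point-injective x≡) ⟩
      x ⊕ offset o′               ≡⟨ point-injective y≡ ⟨
      y                           ∎)
    where open ≡-Reasoning

  view-off : ∀ {c x y} → InnerView c y x → x ≢ y
  view-off (slot y (hubSlot z)) = hub≢point
  view-off (slot y (rimSlot o)) = ⊕-≢ y (0<offset o) (offset<V o) ∘ point-injective

  _on_ : Fin (h + V) → Code → Set
  x on c = x ≡ tail c ⊎ x ≡ head c

  Covered : Fin (h + V) → Fin (h + V) → Set
  Covered x y = ∃[ c ] x on c × y on c

  -- The j-th inner pair has difference 2j + 1: this is how the inner pairs exhaust the odd
  -- differences below 2k.
  lo+odd≡hi : ∀ j → offset (lo j) + suc (toℕ j + toℕ j) ≡ offset (hi j)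
  lo+odd≡hi j = begin
    k ∸ toℕ j + suc (toℕ j + toℕ j)     ≡⟨ ℕ.+-suc (k ∸ toℕ j) (toℕ j + toℕ j) ⟩
    suc (k ∸ toℕ j + (toℕ j + toℕ j))   ≡⟨ cong suc (ℕ.+-assoc (k ∸ toℕ j) (toℕ j) (toℕ j)) ⟨
    suc (k ∸ toℕ j + toℕ j + toℕ j)     ≡⟨ cong (λ l → suc (l + toℕ j)) (ℕ.m∸n+n≡m (ℕ.<⇒≤ (toℕ<n j))) ⟩
    suc (k + toℕ j)                     ∎
    where open ≡-Reasoning

  cover-separated : ∀ {x y} → Separated x y → Covered (point x) (point y)
  cover-separated {x} (e , 0<e , 2e≤V , refl) with every-span 0<e 2e≤V
  ... | inj₂ (j , refl) = outer x j , inj₁ refl , inj₂ refl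
  ... | inj₁ (j , refl) = inner y j , inj₁ (cong point (sym (⊖-⊕ x (offset (lo j))))) , inj₂ (cong point (begin
    x ⊕ e                     ≡⟨ cong (_⊕ e) (⊖-⊕ x (offset (lo j))) ⟨
    y ⊕ offset (lo j) ⊕ e     ≡⟨ ⊕-assoc y (offset (lo j)) e ⟩
    y ⊕ (offset (lo j) + e)   ≡⟨ cong (y ⊕_) (lo+odd≡hi j) ⟩
    y ⊕ offset (hi j)         ∎))
    where
    open ≡-Reasoning
    -- The apex is placed so that x becomes the lower point of its j-th inner pair.
    y = x ⊖ offset (lo j)

  cover-spoke : ∀ z x → Covered (hub z) (point x)
  cover-spoke z x = spoke (x ⊖ offset (over z)) z , inj₁ refl , inj₂ (cong point (sym (⊖-⊕ x (offset (over z)))))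

  hub-unique : ∀ {n} → n ≤ 1 → (z z′ : Fin n) → z ≡ z′
  hub-unique (s≤s z≤n) zero zero = refl

  cover-split : ∀ s t → join h V s ≢ join h V t → Covered (join h V s) (join h V t)
  cover-split (inj₁ z) (inj₁ z′) s≢t = contradiction (cong hub (hub-unique h≤1 z z′)) s≢t
  cover-split (inj₁ z) (inj₂ x)  s≢t = cover-spoke z x
  cover-split (inj₂ x) (inj₁ z)  s≢t = map₂ swap (cover-spoke z x)
  cover-split (inj₂ x) (inj₂ y)  s≢t with separated (s≢t ∘ cong point)
  ... | inj₁ sep = cover-separated sep
  ... | inj₂ sep = map₂ swap (cover-separated sep)

  cover : ∀ {x y} → x ≢ y → Covered x y
  cover {x} {y} x≢y = subst₂ Covered (Fin.join-splitAt h V x) (Fin.join-splitAt h V y)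
    (cover-split (splitAt h x) (splitAt h y)
      (subst₂ _≢_ (sym (Fin.join-splitAt h V x)) (sym (Fin.join-splitAt h V y)) x≢y))

  scheme : Scheme (h + V) r
  scheme = record
    { Code         = Code
    ; tail         = tail
    ; head         = head
    ; apex         = apex
    ; cover        = cover
    ; apex-off     = λ {c} a x-on → view-off (innerView c a x-on) refl
    ; inner-unique = λ {c} {c′} a a′ on on′ → view-unique (innerView c a on) (innerView c′ a′ on′) refl refl
    ; inner-asym   = λ {c} {c′} a on a′ on′ → view-asym (innerView c a on) (innerView c′ a′ on′) refl refl
    ; tail-unique  = outer-tail-unique _ _
    ; head-unique  = outer-head-unique _ _
    }
    where
    -- For a fixed new point j the pairs are the translates {t , t + span j}, so either end alone
    -- determines t.
    outer-tail-unique : ∀ c c′ {u} → apex c ≡ inj₂ u → apex c′ ≡ inj₂ u → tail c ≡ tail c′ → c ≡ c′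
    outer-tail-unique (outer t j) (outer t′ j) refl refl eq = cong (λ t → outer t j) (point-injective eq)
    outer-head-unique : ∀ c c′ {u} → apex c ≡ inj₂ u → apex c′ ≡ inj₂ u → head c ≡ head c′ → c ≡ c′
    outer-head-unique (outer t j) (outer t′ j) refl refl eq =
      cong (λ t → outer t j) (⊕-cancelʳ (span j) (point-injective eq))

-- Differences by parity, and a scheme for each residue of v modulo 4.

halve : ∀ n → ∃[ m ] (n ≡ m + m ⊎ n ≡ suc (m + m))
halve zero = 0 , inj₁ refl
halve (suc n) with halve n
... | m , inj₁ eq = m , inj₂ (cong suc eq)
... | m , inj₂ eq = suc m , inj₁ (cong suc (trans eq (sym (ℕ.+-suc m m))))

double-cancel-< : ∀ {m n} → m + m < n + n → m < n
double-cancel-< {m} {n} 2m<2n = ℕ.≰⇒> λ n≤m → ℕ.<⇒≱ 2m<2n (ℕ.+-mono-≤ n≤m n≤m)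

evenSpan : ∀ {k} → Fin k → ℕ
evenSpan j = suc (toℕ j) + suc (toℕ j)

-- For V = 4k + 2 or 4k + 3 the differences reach 2k + 1, while inner pairs stop at 2k - 1; this
-- longest one gets a new point of its own.
evenOrLongSpan : ∀ {k} → Fin (suc k) → ℕ
evenOrLongSpan {k} zero = suc (k + k)
evenOrLongSpan (suc j)  = evenSpan j

odd-or-even : ∀ {k e} → 0 < e → e ≤ k + k →
              (∃[ j ] e ≡ suc (toℕ {k} j + toℕ j)) ⊎ (∃[ j ] e ≡ evenSpan {k} j)
-- It is the predecessor of the difference that is halved: an even predecessor means an odd
-- difference.
odd-or-even {k} {suc e} _ e<2k with halve e
... | m , inj₁ refl = inj₁ (fromℕ< m<k , cong (λ l → suc (l + l)) (sym (toℕ-fromℕ< m<k)))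
  where m<k = double-cancel-< {m} e<2k
... | m , inj₂ refl = inj₂ (fromℕ< m<k ,
  trans (cong suc (sym (ℕ.+-suc m m))) (cong (λ l → suc l + suc l) (sym (toℕ-fromℕ< m<k))))
  where m<k = double-cancel-< {m} (ℕ.<-trans (ℕ.n<1+n _) e<2k)

odd-even-or-long : ∀ {k e} → 0 < e → e ≤ suc (k + k) →
                   (∃[ j ] e ≡ suc (toℕ {k} j + toℕ j)) ⊎ (∃[ j ] e ≡ evenOrLongSpan {k} j)
odd-even-or-long {k} 0<e e≤ with ℕ.m≤n⇒m<n∨m≡n e≤
... | inj₁ e<   = Sum.map₂ (λ (j , eq) → suc j , eq) (odd-or-even 0<e (s≤s⁻¹ e<))
... | inj₂ refl = inj₂ (zero , refl)

2e≤1+4k⇒e≤2k : ∀ k {e} → e + e ≤ suc (k * 4) → e ≤ k + k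
2e≤1+4k⇒e≤2k k {e} 2e≤ = s≤s⁻¹ (double-cancel-< (begin-strict
  e + e                       ≤⟨ 2e≤ ⟩
  suc (k * 4)                 <⟨ ℕ.n<1+n _ ⟩
  suc (suc (k * 4))           ≡⟨ double k ⟨
  suc (k + k) + suc (k + k)   ∎))
  where
  open ℕ.≤-Reasoning
  double : ∀ k → suc (k + k) + suc (k + k) ≡ suc (suc (k * 4))
  double = solve-∀

2e≤3+4k⇒e≤1+2k : ∀ k {e} → e + e ≤ suc (2 + k * 4) → e ≤ suc (k + k)
2e≤3+4k⇒e≤1+2k k {e} 2e≤ = s≤s⁻¹ (double-cancel-< (begin-strict
  e + e                           ≤⟨ 2e≤ ⟩
  suc (2 + k * 4)                 <⟨ ℕ.n<1+n _ ⟩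
  suc (suc (2 + k * 4))           ≡⟨ double k ⟨
  suc (suc (k + k)) + suc (suc (k + k))   ∎))
  where
  open ℕ.≤-Reasoning
  double : ∀ k → suc (suc (k + k)) + suc (suc (k + k)) ≡ suc (suc (2 + k * 4))
  double = solve-∀

-- Of the differences 1, ..., 2k the k odd ones are nested inside X and the k even ones get a new
-- point each. The offsets just fit, as 4k < V.
scheme₁ : ∀ k → Scheme (suc (k * 4)) k
scheme₁ k = CyclicScheme.scheme (suc (k * 4)) 0 k k z≤n (s≤s (ℕ.≤-reflexive (double k))) evenSpan
  (λ 0<e 2e≤V → odd-or-even 0<e (2e≤1+4k⇒e≤2k k 2e≤V))
  where
  double : ∀ k → k + k + 0 + (k + k + 0) ≡ k * 4
  double = solve-∀

-- Here 2k + 1 = V/2, so each pair with this difference has two codes, oriented oppositely; tails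
-- and heads still determine the code.
scheme₂ : ∀ k → Scheme (suc (1 + k * 4)) (suc k)
scheme₂ k = CyclicScheme.scheme (suc (1 + k * 4)) 0 k (suc k) z≤n (s≤s (ℕ.m≤n⇒m≤1+n (ℕ.≤-reflexive (double k))))
  evenOrLongSpan
  (λ 0<e 2e≤V → odd-even-or-long 0<e (2e≤3+4k⇒e≤1+2k k (ℕ.m≤n⇒m≤1+n 2e≤V)))
  where
  double : ∀ k → k + k + 0 + (k + k + 0) ≡ k * 4
  double = solve-∀

-- Here V = 4k + 3. A hub adds a point to X but costs no new point, since its pairs are nested
-- inside X. The offsets then reach 2k + 1 and still fit, as 2(2k + 1) = V - 1.
scheme₃₄ : ∀ h k → h ≤ 1 → Scheme (h + suc (2 + k * 4)) (suc k)
scheme₃₄ h k h≤1 = CyclicScheme.scheme (suc (2 + k * 4)) h k (suc k) h≤1 (s≤s (begin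
    k + k + h + (k + k + h)   ≤⟨ ℕ.+-mono-≤ (ℕ.+-monoʳ-≤ (k + k) h≤1) (ℕ.+-monoʳ-≤ (k + k) h≤1) ⟩
    k + k + 1 + (k + k + 1)   ≡⟨ double k ⟩
    2 + k * 4                 ∎))
  evenOrLongSpan
  (λ 0<e 2e≤V → odd-even-or-long 0<e (2e≤3+4k⇒e≤1+2k k 2e≤V))
  where
  open ℕ.≤-Reasoning
  double : ∀ k → k + k + 1 + (k + k + 1) ≡ 2 + k * 4
  double = solve-∀

-- The number of points attained.

quotient : ∀ {m} c q → c < 4 → m ≡ c + q * 4 → m / 4 ≡ q
quotient c q c<4 refl = begin
  (c + q * 4) / 4       ≡⟨ +-distrib-/-∣ʳ c (n∣m*n q) ⟩
  c / 4 + q * 4 / 4     ≡⟨ cong₂ _+_ (m<n⇒m/n≡0 c<4) (m*n/n≡m q 4) ⟩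
  q                     ∎
  where open ≡-Reasoning

-- The cases are v - 1 = 4k + c for c = 0, 1, 2, 3. The numerator 5v + 2 of the ceiling then has
-- remainder 3, 0, 1, 2 modulo 4, which is the first argument of `quotient`.
optimalScheme : ∀ n → ∃[ r ] Scheme (suc n) r × ⌈ (5 * suc n ∸ 1) / 4 ⌉ ≡ suc n + r
optimalScheme n with n divMod 4
... | result k zero refl = k , scheme₁ k , quotient 3 _ (ℕ.m≤m+n 4 0) (arith k)
  where
  -- `5 * suc n ∸ 1` computes to `n + 4 * suc n`, so the ring solver meets no truncated subtraction.
  arith : ∀ k → k * 4 + 4 * suc (k * 4) + 3 ≡ 3 + (suc (k * 4) + k) * 4
  arith = solve-∀
... | result k (suc zero) refl = suc k , scheme₂ k , quotient 0 _ (ℕ.m≤m+n 1 3) (arith k)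
  where
  arith : ∀ k → suc (k * 4) + 4 * suc (suc (k * 4)) + 3 ≡ (suc (suc (k * 4)) + suc k) * 4
  arith = solve-∀
... | result k (suc (suc zero)) refl = suc k , scheme₃₄ 0 k z≤n , quotient 1 _ (ℕ.m≤m+n 2 2) (arith k)
  where
  arith : ∀ k → 2 + k * 4 + 4 * suc (2 + k * 4) + 3 ≡ 1 + (suc (2 + k * 4) + suc k) * 4
  arith = solve-∀
... | result k (suc (suc (suc zero))) refl = suc k , scheme₃₄ 1 k (s≤s z≤n) , quotient 2 _ (ℕ.m≤m+n 3 1) (arith k)
  where
  arith : ∀ k → 3 + k * 4 + 4 * suc (3 + k * 4) + 3 ≡ 2 + (suc (3 + k * 4) + suc k) * 4
  arith = solve-∀

optimalNesting : ∀ {v} → 1 ≤ v → (𝒟 : BIBD v 2 1) → WeakNesting 𝒟 ⌈ (5 * v ∸ 1) / 4 ⌉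
optimalNesting {suc n} _ 𝒟 = let r , S , eq = optimalScheme n in
  subst (WeakNesting 𝒟) (sym eq) (Realize.weakNesting S 𝒟)

theorem2p1 : (v : ℕ) → 2 ≤ v → (𝒟 : BIBD v 2 1) →
    Σ[ N ∈ WeakNesting 𝒟 ⌈ (5 * v ∸ 1) / 4 ⌉ ] IsOptimal N
theorem2p1 v 2≤v 𝒟 = optimalNesting (ℕ.<⇒≤ 2≤v) 𝒟 , λ N → LowerBound.bound 𝒟 N (ℕ.<⇒≤ 2≤v)
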